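{- Let $G$ be a graph of pathwidth $w\geq 2$ and let $k\geq w+1$ be an integer (with $k\leq |V(G)|$, so that $\operatorname{nc}(G,k)$ is defined). Then $\operatorname{nc}(G,k)\leq (k-w+2)2^{w-1}+2k-w-2$.
   Context: All graphs are finite, simple and undirected. For a vertex $v$ of a graph $G$, $N[v]$ denotes the closed neighbourhood of $v$ ($v$ together with its neighbours). For a graph $G=(V,E)$ and $S\subseteq V$, $\operatorname{nc}(G,S)=|\{N[u]\cap S : u\in V\}|$ (the empty intersection is counted if it occurs). For an integer $k$, $\operatorname{nc}(G,k)=\max_{S\subseteq V,\ |S|=k}\operatorname{nc}(G,S)$. A path-decomposition of $G$ is a pair $(P,X)$ where $P$ is a path and $X$ maps each node of $P$ to a subset of $V(G)$ (its bag), such that every edge of $G$ is contained in some bag, and for every $v\in V(G)$ the set of nodes whose bags contain $v$ induces a non-empty subpath of $P$. Its width is the maximum bag size minus $1$; the pathwidth of $G$ is the minimum width of a path-decomposition of $G$. -}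

module Defs where

open import Data.Bool.Properties using () renaming (_≟_ to _≟ᵇ_)
open import Data.Fin.Base using (Fin) renaming (_≤_ to _≤ᶠ_)
open import Data.Fin.Properties using () renaming (_≟_ to _≟ᶠ_)
open import Data.Fin.Subset using (Subset; inside; outside; _∈_; _∩_; ∣_∣)
open import Data.List.Base
  using (List; []; _∷_; [_]; _++_; map; filter; length; allFin; deduplicate)
open import Data.List.Extrema.Nat using (max)
import Data.List.Membership.Propositional as List
open import Data.List.Membership.Propositional.Properties
  using (∈-map⁺; ∈-++⁺ˡ; ∈-++⁺ʳ)
open import Data.List.Relation.Unary.Any using (here)
open import Data.Nat.Base using (ℕ; zero; suc; _∸_; _≤_)
open import Data.Nat.Properties using (_≟_)
open import Data.Product.Base using (∃; ∃₂; _×_)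
import Data.Vec.Base as Vec
import Data.Vec.Properties as Vec
open import Function.Bundles using (_⇔_)
open import Level using (0ℓ)
open import Relation.Binary.Core using (Rel)
open import Relation.Binary.Definitions
  using (Symmetric; Irreflexive; Decidable; DecidableEquality)
open import Relation.Binary.PropositionalEquality using (_≡_; refl)
open import Relation.Nullary.Decidable using (does; _⊎-dec_)

-- Simple undirected graphs with vertex set Fin n.
record Graph (n : ℕ) : Set₁ where
  infix 4 _~_ _~?_
  field
    _~_      : Rel (Fin n) 0ℓ
    _~?_     : Decidable _~_
    ~-sym    : Symmetric _~_
    ~-irrefl : Irreflexive _≡_ _~_

  N[_] : Fin n → Subset n
  N[ u ] = Vec.tabulate λ v → does ((v ≟ᶠ u) ⊎-dec (u ~? v))

_≟ˢ_ : ∀ {n} → DecidableEquality (Subset n)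
_≟ˢ_ = Vec.≡-dec _≟ᵇ_

allSubsets : ∀ n → List (Subset n)
allSubsets zero    = [ Vec.[] ]
allSubsets (suc n) =
  map (inside Vec.∷_) (allSubsets n) ++ map (outside Vec.∷_) (allSubsets n)

∈-allSubsets : ∀ {n} (S : Subset n) → S List.∈ allSubsets n
∈-allSubsets Vec.[]              = here refl
∈-allSubsets (inside  Vec.∷ S) =
  ∈-++⁺ˡ (∈-map⁺ (inside Vec.∷_) (∈-allSubsets S))
∈-allSubsets (outside Vec.∷ S) =
  ∈-++⁺ʳ (map (inside Vec.∷_) (allSubsets _))
         (∈-map⁺ (outside Vec.∷_) (∈-allSubsets S))

module _ {n : ℕ} (G : Graph n) where
  open Graph G

  -- |{ N[u] ∩ S : u ∈ V }|
  ncSet : Subset n → ℕ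
  ncSet S = length (deduplicate _≟ˢ_ (map (λ u → N[ u ] ∩ S) (allFin n)))

  -- The maximum of ncSet over the k-element vertex subsets. The default value 0
  -- only matters when there are none, that is when k > n.
  nc : ℕ → ℕ
  nc k = max 0 (map ncSet (filter (λ S → ∣ S ∣ ≟ k) (allSubsets n)))

  -- The nodes of the path are 0, 1, …, m in this order (a path has at least one
  -- node), so its non-empty subpaths are the intervals [a, b] with a ≤ b.
  record PathDecomposition : Set where
    field
      m       : ℕ
      bag     : Fin (suc m) → Subset n
      edges   : ∀ {u v} → u ~ v → ∃ λ i → u ∈ bag i × v ∈ bag i
      subpath : ∀ v → ∃₂ λ (a b : Fin (suc m)) →
                a ≤ᶠ b × (∀ i → v ∈ bag i ⇔ (a ≤ᶠ i × i ≤ᶠ b))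

    -- Truncated subtraction only matters for the graph without vertices, whose
    -- width is 0 here rather than -1.
    width : ℕ
    width = max 0 (map (λ i → ∣ bag i ∣) (allFin (suc m))) ∸ 1

  open PathDecomposition using (width)

  HasPathwidth : ℕ → Set
  HasPathwidth w =
    (∃ λ (D : PathDecomposition) → width D ≡ w) ×
    (∀ (D : PathDecomposition) → w ≤ width D)

-- View a path-decomposition as a family of intervals, one per vertex, with at most
-- w + 1 of them over each node. Delete from S the vertex y whose interval starts last.
-- The traces of vertices outside S that contain y are of two kinds: at most 2^(w-1)
-- subsets of S ∩ (the bag where y starts), and those of vertices lying in that bag;
-- each of the latter takes a place in the bag and so halves the number of subsets.
-- Hence a deletion loses at most 2^(w-1) + 1 traces, and only 2^(w-1) if that bag has
-- w + 1 elements in S. The w vertices left at the end account for at most 2^w traces,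
-- and the k vertices of S for one more trace each. This exceeds the bound by 2; one
-- trace is saved at each of the two ends of the path.
module Submission where

open import Defs
open import Data.Fin.Base using (Fin; zero; suc) renaming (_≤_ to _≤ᶠ_)
import Data.Fin.Properties as Fin
open import Data.Fin.Subset
  using (Subset; Side; Nonempty; inside; outside; _∈_; _∉_; _⊆_; _∩_; _∪_; _─_; _-_; ⁅_⁆; ∣_∣)
open import Data.Fin.Subset.Properties
open import Data.List.Base using (List; []; _∷_; map; length; allFin)
open import Data.List.Extrema.Nat using (max; max≤v⁺; xs≤max)
open import Data.List.Membership.Propositional.Properties
  using (∈-deduplicate⁻; ∈-map⁻; ∈-map⁺; ∈-allFin)
open import Data.List.Properties using (length-map)
open import Data.List.Relation.Unary.All as All using (All; []; _∷_)
import Data.List.Relation.Unary.All.Properties as All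
open import Data.List.Relation.Unary.AllPairs using ([]; _∷_)
open import Data.List.Relation.Unary.Unique.DecPropositional.Properties using (deduplicate-!)
open import Data.List.Relation.Unary.Unique.Propositional using (Unique)
open import Data.List.Relation.Unary.Unique.Propositional.Properties using (map⁻)
open import Data.Nat.Base
  using (ℕ; zero; suc; _+_; _*_; _∸_; _^_; _≤_; _<_; z≤n; s≤s; s≤s⁻¹)
open import Data.Nat.Properties
open import Data.Nat.Tactic.RingSolver using (solve-∀)
open import Data.Product.Base using (∃; ∃₂; _×_; _,_; proj₁; proj₂)
open import Data.Sum.Base using (_⊎_; inj₁; inj₂)
open import Data.Unit.Base using () renaming (⊤ to Unit)
import Data.Vec.Base as Vec
open import Data.Vec.Properties using (lookup⇒[]=; []=⇒lookup; lookup∘tabulate)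
open import Function.Base using (_∘_; id)
open import Function.Bundles using (Equivalence)
open import Level using (0ℓ)
open import Relation.Binary.Core using (Rel)
open import Relation.Binary.Definitions using (Total; Transitive)
open import Relation.Binary.PropositionalEquality
open import Relation.Nullary.Negation using (¬_; contradiction)
open import Relation.Nullary.Decidable
  using (Dec; yes; no; does; _⊎-dec_; _×-dec_; ¬?; dec-true; decidable-stable)

-- Upper bounds on the number of elements with a property

-- A bound on all duplicate-free lists serves properties such as being a trace, whose elements are
-- given only by existence and never enumerated.
AtMost : {A : Set} → (A → Set) → ℕ → Set
AtMost P c = ∀ {xs} → Unique xs → All P xs → length xs ≤ c

module _ {A : Set} where

  AtMost-mono : ∀ {P Q : A → Set} {c d} → (∀ {x} → Q x → P x) → c ≤ d →
                AtMost P c → AtMost Q d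
  AtMost-mono Q⊆P c≤d P≤c xs! Qxs = ≤-trans (P≤c xs! (All.map Q⊆P Qxs)) c≤d

  AtMost-≤ : ∀ {P : A → Set} {c d} → c ≤ d → AtMost P c → AtMost P d
  AtMost-≤ = AtMost-mono id

  AtMost-∅ : ∀ {P : A → Set} → (∀ {x} → ¬ P x) → AtMost P 0
  AtMost-∅ ¬P _ []       = z≤n
  AtMost-∅ ¬P _ (px ∷ _) = contradiction px ¬P

  AtMost-≡ : ∀ (x : A) → AtMost (_≡ x) 1
  AtMost-≡ x []              []                = z≤n
  AtMost-≡ x (_ ∷ [])        (_ ∷ [])          = s≤s z≤n
  AtMost-≡ x ((x≢x ∷ _) ∷ _) (refl ∷ refl ∷ _) = contradiction refl x≢x

  AtMost-∪ : ∀ {P Q R : A → Set} {c d} → (∀ {x} → R x → P x ⊎ Q x) →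
             AtMost P c → AtMost Q d → AtMost R (c + d)
  AtMost-∪ {P} {Q} R⊆P∪Q P≤c Q≤d xs! Rxs =
    let ys , zs , (ys! , Pys , _) , (zs! , Qzs , _) , eq = split xs! (All.map R⊆P∪Q Rxs)
    in ≤-trans (≤-reflexive eq) (+-mono-≤ (P≤c ys! Pys) (Q≤d zs! Qzs))
    where
    -- The last component carries freshness from the list to the sublist, which keeps the sublist
    -- duplicate-free as it grows.
    Part : (A → Set) → List A → List A → Set
    Part S xs ys = Unique ys × All S ys × (∀ {z} → All (z ≢_) xs → All (z ≢_) ys)

    split : ∀ {xs} → Unique xs → All (λ x → P x ⊎ Q x) xs →
            ∃₂ λ ys zs → Part P xs ys × Part Q xs zs × length xs ≡ length ys + length zs
    split []           []        = [] , [] , ([] , [] , id) , ([] , [] , id) , refl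
    split (x∉ ∷ xs!) (px ∷ pxs) with split xs! pxs
    split (x∉ ∷ xs!) (inj₁ p ∷ pxs)
      | ys , zs , (ys! , Pys , ys⊆) , (zs! , Qzs , zs⊆) , eq
      = _ ∷ ys , zs
      , (ys⊆ x∉ ∷ ys! , p ∷ Pys , λ { (z≢ ∷ z∉) → z≢ ∷ ys⊆ z∉ })
      , (zs! , Qzs , λ { (_ ∷ z∉) → zs⊆ z∉ })
      , cong suc eq
    split (x∉ ∷ xs!) (inj₂ q ∷ pxs)
      | ys , zs , (ys! , Pys , ys⊆) , (zs! , Qzs , zs⊆) , eq
      = ys , _ ∷ zs
      , (ys! , Pys , λ { (_ ∷ z∉) → ys⊆ z∉ })
      , (zs⊆ x∉ ∷ zs! , q ∷ Qzs , λ { (z≢ ∷ z∉) → z≢ ∷ zs⊆ z∉ })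
      , trans (cong suc eq) (sym (+-suc (length ys) (length zs)))

  -- Choose one preimage for each list entry; distinct images force distinct preimages.
  AtMost-image : ∀ {B : Set} {P : A → Set} {Q : B → Set} {c} (f : A → B) →
                 (∀ {y} → Q y → ∃ λ x → P x × f x ≡ y) → AtMost P c → AtMost Q c
  AtMost-image {B} {P} {Q} {c} f lift P≤c ys! Qys = bound (preimages Qys) ys!
    where
    preimages : ∀ {ys} → All Q ys → ∃ λ xs → All P xs × map f xs ≡ ys
    preimages []         = [] , [] , refl
    preimages (qy ∷ qys) with x , px , refl ← lift qy | xs , pxs , refl ← preimages qys
      = x ∷ xs , px ∷ pxs , refl

    bound : ∀ {ys} → (∃ λ xs → All P xs × map f xs ≡ ys) → Unique ys → length ys ≤ c
    bound (xs , pxs , refl) ys! = ≤-trans (≤-reflexive (length-map f xs)) (P≤c (map⁻ ys!) pxs)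

-- Counting elements and subsets of a finite set

AtMost-∈ : ∀ {n} (S : Subset n) → AtMost (_∈ S) ∣ S ∣
AtMost-∈ Vec.[]            = AtMost-∅ λ ()
AtMost-∈ (outside Vec.∷ S) =
  AtMost-image suc (λ { (Vec.there x∈S) → _ , x∈S , refl }) (AtMost-∈ S)
AtMost-∈ (inside Vec.∷ S)  =
  AtMost-∪ {P = _≡ zero} {Q = λ x → ∃ λ y → y ∈ S × suc y ≡ x}
    (λ { Vec.here → inj₁ refl ; (Vec.there x∈S) → inj₂ (_ , x∈S , refl) })
    (AtMost-≡ zero)
    (AtMost-image suc id (AtMost-∈ S))

AtMost-⊆ : ∀ {n} (S : Subset n) → AtMost (_⊆ S) (2 ^ ∣ S ∣)
AtMost-⊆ Vec.[]            =
  AtMost-mono (λ { {Vec.[]} _ → refl }) ≤-refl (AtMost-≡ Vec.[])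
AtMost-⊆ (outside Vec.∷ S) = AtMost-image (outside Vec.∷_) lift (AtMost-⊆ S)
  where
  lift : ∀ {T} → T ⊆ outside Vec.∷ S → ∃ λ T′ → T′ ⊆ S × outside Vec.∷ T′ ≡ T
  lift {outside Vec.∷ T} T⊆S = T , drop-∷-⊆ T⊆S , refl
  lift {inside  Vec.∷ T} T⊆S = contradiction (T⊆S Vec.here) λ ()
AtMost-⊆ (inside Vec.∷ S)  =
  AtMost-≤ (≤-reflexive (cong (2 ^ ∣ S ∣ +_) (sym (+-identityʳ _))))
    (AtMost-∪ split (extended inside) (extended outside))
  where
  Extended : Side → Subset _ → Set
  Extended s T = ∃ λ T′ → T′ ⊆ S × s Vec.∷ T′ ≡ T

  extended : ∀ s → AtMost (Extended s) (2 ^ ∣ S ∣)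
  extended s = AtMost-image (s Vec.∷_) id (AtMost-⊆ S)

  split : ∀ {T} → T ⊆ inside Vec.∷ S → Extended inside T ⊎ Extended outside T
  split {inside  Vec.∷ T} T⊆S = inj₁ (T , drop-∷-⊆ T⊆S , refl)
  split {outside Vec.∷ T} T⊆S = inj₂ (T , drop-∷-⊆ T⊆S , refl)

x∈p─q⇒x∉q : ∀ {n} {x : Fin n} (p q : Subset n) → x ∈ p ─ q → x ∉ q
x∈p─q⇒x∉q (_ Vec.∷ p) (outside Vec.∷ q) Vec.here       ()
x∈p─q⇒x∉q (_ Vec.∷ p) (inside  Vec.∷ q) (Vec.there x∈) (Vec.there x∈q) = x∈p─q⇒x∉q p q x∈ x∈q
x∈p─q⇒x∉q (_ Vec.∷ p) (outside Vec.∷ q) (Vec.there x∈) (Vec.there x∈q) = x∈p─q⇒x∉q p q x∈ x∈q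

x∉p-x : ∀ {n} (p : Subset n) x → x ∉ p - x
x∉p-x p x x∈p-x = x∈p─q⇒x∉q p ⁅ x ⁆ x∈p-x (x∈⁅x⁆ x)

∣p─q∣+∣p∩q∣≡∣p∣ : ∀ {n} (p q : Subset n) → ∣ p ─ q ∣ + ∣ p ∩ q ∣ ≡ ∣ p ∣
∣p─q∣+∣p∩q∣≡∣p∣ Vec.[] Vec.[] = refl
∣p─q∣+∣p∩q∣≡∣p∣ (inside  Vec.∷ p) (inside  Vec.∷ q) =
  trans (+-suc _ _) (cong suc (∣p─q∣+∣p∩q∣≡∣p∣ p q))
∣p─q∣+∣p∩q∣≡∣p∣ (inside  Vec.∷ p) (outside Vec.∷ q) = cong suc (∣p─q∣+∣p∩q∣≡∣p∣ p q)
∣p─q∣+∣p∩q∣≡∣p∣ (outside Vec.∷ p) (inside  Vec.∷ q) = ∣p─q∣+∣p∩q∣≡∣p∣ p q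
∣p─q∣+∣p∩q∣≡∣p∣ (outside Vec.∷ p) (outside Vec.∷ q) = ∣p─q∣+∣p∩q∣≡∣p∣ p q

0<∣p∣⇒Nonempty : ∀ {n} {p : Subset n} → 0 < ∣ p ∣ → Nonempty p
0<∣p∣⇒Nonempty {n} {p} 0<∣p∣ with nonempty? p
... | yes p≢∅ = p≢∅
... | no  p≡∅ =
  contradiction (subst (0 <_) (trans (cong ∣_∣ (Empty-unique p≡∅)) (∣⊥∣≡0 n)) 0<∣p∣) λ ()

-- A subset through `x` is determined by its remainder in `S - x`. If `x` is not in `S`, there is
-- none; this covers uses where `x` itself may have been removed from the ambient set.
AtMost-∋⊆ : ∀ {n} (x : Fin n) (S : Subset n) {c} → ∣ S ∣ ≤ suc c →
            AtMost (λ T → x ∈ T × T ⊆ S) (2 ^ c)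
AtMost-∋⊆ x S {c} ∣S∣≤ with x ∈? S
... | no  x∉S = AtMost-≤ z≤n (AtMost-∅ λ (x∈T , T⊆S) → x∉S (T⊆S x∈T))
... | yes x∈S = AtMost-≤ (^-monoʳ-≤ 2 (s≤s⁻¹ (≤-trans (x∈p⇒∣p-x∣<∣p∣ x∈S) ∣S∣≤)))
                  (AtMost-image (_∪ ⁅ x ⁆) lift (AtMost-⊆ (S - x)))
  where
  lift : ∀ {T} → x ∈ T × T ⊆ S → ∃ λ T′ → T′ ⊆ S - x × T′ ∪ ⁅ x ⁆ ≡ T
  lift {T} (x∈T , T⊆S) = T - x , T-x⊆S-x , ⊆-antisym ∪⊆T T⊆∪
    where
    T-x⊆S-x : T - x ⊆ S - x
    T-x⊆S-x z∈ = x∈p∧x≢y⇒x∈p-y (T⊆S (p─q⊆p T ⁅ x ⁆ z∈)) λ { refl → x∉p-x T x z∈ }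

    ∪⊆T : (T - x) ∪ ⁅ x ⁆ ⊆ T
    ∪⊆T z∈ with x∈p∪q⁻ (T - x) ⁅ x ⁆ z∈
    ... | inj₁ z∈T-x = p─q⊆p T ⁅ x ⁆ z∈T-x
    ... | inj₂ z∈x   = subst (_∈ T) (sym (x∈⁅y⁆⇒x≡y x z∈x)) x∈T

    T⊆∪ : T ⊆ (T - x) ∪ ⁅ x ⁆
    T⊆∪ {z} z∈T with z Fin.≟ x
    ... | yes refl = x∈p∪q⁺ (inj₂ (x∈⁅x⁆ x))
    ... | no  z≢x  = x∈p∪q⁺ (inj₁ (x∈p∧x≢y⇒x∈p-y z∈T z≢x))

-- Extremal elements of a subset, and auxiliary facts

module _ {A : Set} {_≼_ : Rel A 0ℓ} (≼-total : Total _≼_) (≼-trans : Transitive _≼_) where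

  private
    ≼-refl : ∀ x → x ≼ x
    ≼-refl x with ≼-total x x
    ... | inj₁ x≼x = x≼x
    ... | inj₂ x≼x = x≼x

  argmax : ∀ {n} (f : Fin n → A) {S : Subset n} → Nonempty S →
           ∃ λ y → y ∈ S × (∀ {z} → z ∈ S → f z ≼ f y)
  argmax f {outside Vec.∷ S} (suc x , Vec.there x∈S)
    with y , y∈S , y-max ← argmax (f ∘ suc) (x , x∈S)
    = suc y , Vec.there y∈S , λ { (Vec.there z∈S) → y-max z∈S }
  argmax f {inside Vec.∷ S} _ with nonempty? S
  ... | no  S≡∅ = zero , Vec.here , λ where
    Vec.here        → ≼-refl (f zero)
    (Vec.there z∈S) → contradiction (_ , z∈S) S≡∅
  ... | yes S≢∅ with y , y∈S , y-max ← argmax (f ∘ suc) S≢∅ | ≼-total (f zero) (f (suc y))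
  ...   | inj₁ 0≼y = suc y , Vec.there y∈S , λ where
    Vec.here        → 0≼y
    (Vec.there z∈S) → y-max z∈S
  ...   | inj₂ y≼0 = zero , Vec.here , λ where
    Vec.here        → ≼-refl (f zero)
    (Vec.there z∈S) → ≼-trans (y-max z∈S) y≼0

∈-tabulate⁻ : ∀ {n} {f : Fin n → Side} {x} → x ∈ Vec.tabulate f → f x ≡ inside
∈-tabulate⁻ {f = f} {x} x∈ = trans (sym (lookup∘tabulate f x)) ([]=⇒lookup x∈)

∈-tabulate⁺ : ∀ {n} {f : Fin n → Side} {x} → f x ≡ inside → x ∈ Vec.tabulate f
∈-tabulate⁺ {f = f} {x} fx = lookup⇒[]= x _ (trans (lookup∘tabulate f x) fx)

-- Each doubling adds at least 1. Thus `d` vertices that each halve the number of available subsets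
-- can be paid for by the subsets lost.
2^m+d≤2^[m+d] : ∀ m d → 2 ^ m + d ≤ 2 ^ (m + d)
2^m+d≤2^[m+d] m zero    = ≤-reflexive (trans (+-identityʳ _) (cong (2 ^_) (sym (+-identityʳ m))))
2^m+d≤2^[m+d] m (suc d) = begin
  2 ^ m + suc d               ≡⟨ +-suc (2 ^ m) d ⟩
  suc (2 ^ m + d)             ≤⟨ s≤s (2^m+d≤2^[m+d] m d) ⟩
  1 + 2 ^ (m + d)             ≤⟨ +-monoˡ-≤ (2 ^ (m + d)) (m^n>0 2 (m + d)) ⟩
  2 ^ (m + d) + 2 ^ (m + d)   ≡⟨ cong (2 ^ (m + d) +_) (sym (+-identityʳ _)) ⟩
  2 ^ suc (m + d)             ≡⟨ cong (2 ^_) (sym (+-suc m d)) ⟩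
  2 ^ (m + suc d)             ∎
  where open ≤-Reasoning

-- Closed neighbourhoods and their traces

module _ {n : ℕ} (G : Graph n) where
  open Graph G

  ∈N⁻ : ∀ {u v} → v ∈ N[ u ] → v ≡ u ⊎ u ~ v
  ∈N⁻ {u} {v} v∈ = invert ((v Fin.≟ u) ⊎-dec (u ~? v)) (∈-tabulate⁻ v∈)
    where
    invert : ∀ {P : Set} (P? : Dec P) → does P? ≡ inside → P
    invert (yes p) _ = p

  ∈N⁺ : ∀ {u v} → v ≡ u ⊎ u ~ v → v ∈ N[ u ]
  ∈N⁺ {u} {v} p = ∈-tabulate⁺ (dec-true ((v Fin.≟ u) ⊎-dec (u ~? v)) p)

  ∈N-refl : ∀ u → u ∈ N[ u ]
  ∈N-refl u = ∈N⁺ (inj₁ refl)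

  ∈N-sym : ∀ {u v} → v ∈ N[ u ] → u ∈ N[ v ]
  ∈N-sym v∈ with ∈N⁻ v∈
  ... | inj₁ v≡u = ∈N⁺ (inj₁ (sym v≡u))
  ... | inj₂ u~v = ∈N⁺ (inj₂ (~-sym u~v))

  Trace : (Fin n → Set) → Subset n → Subset n → Set
  Trace P S T = ∃ λ u → P u × N[ u ] ∩ S ≡ T

  AtMost-Trace : ∀ {P : Fin n → Set} {S c} → AtMost P c → AtMost (Trace P S) c
  AtMost-Trace {S = S} = AtMost-image (λ u → N[ u ] ∩ S) id

  ncSet≤ : ∀ {S c} → AtMost (Trace (λ _ → Unit) S) c → ncSet G S ≤ c
  ncSet≤ {S} ≤c = ≤c (deduplicate-! _≟ˢ_ traces) (All.tabulate λ T∈ →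
    let u , _ , T≡ = ∈-map⁻ (λ u → N[ u ] ∩ S) (∈-deduplicate⁻ _≟ˢ_ traces T∈)
    in u , _ , sym T≡)
    where
    traces : List (Subset n)
    traces = map (λ u → N[ u ] ∩ S) (allFin n)

  nc≤ : ∀ {k c} → (∀ S → ∣ S ∣ ≡ k → ncSet G S ≤ c) → nc G k ≤ c
  nc≤ {k} ≤c = max≤v⁺ z≤n
    (All.map⁺ (All.map (λ {S} → ≤c S) (All.all-filter (λ S → ∣ S ∣ ≟ k) (allSubsets n))))

-- A path-decomposition as a family of intervals

module _ {n : ℕ} (G : Graph n) (D : PathDecomposition G) where
  open Graph G
  open PathDecomposition D

  ∣bag∣≤1+width : ∀ {w} → width ≡ suc w → ∀ i → ∣ bag i ∣ ≤ suc (suc w)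
  ∣bag∣≤1+width {w} width≡ i = begin
    ∣ bag i ∣  ≤⟨ All.lookup (xs≤max 0 sizes) (∈-map⁺ (λ i → ∣ bag i ∣) (∈-allFin i)) ⟩
    max₀       ≤⟨ m≤n+m∸n max₀ 1 ⟩
    suc width  ≡⟨ cong suc width≡ ⟩
    suc (suc w) ∎
    where
    open ≤-Reasoning
    sizes = map (λ i → ∣ bag i ∣) (allFin (suc m))
    max₀ = max 0 sizes

  left right : Fin n → Fin (suc m)
  left v = proj₁ (subpath v)
  right   v = proj₁ (proj₂ (subpath v))

  ∈bag⁺ : ∀ {v i} → left v ≤ᶠ i → i ≤ᶠ right v → v ∈ bag i
  ∈bag⁺ {v} {i} s≤i i≤e = Equivalence.from (proj₂ (proj₂ (proj₂ (subpath v))) i) (s≤i , i≤e)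

  left≤ : ∀ {v i} → v ∈ bag i → left v ≤ᶠ i
  left≤ {v} {i} v∈ = proj₁ (Equivalence.to (proj₂ (proj₂ (proj₂ (subpath v))) i) v∈)

  ≤right : ∀ {v i} → v ∈ bag i → i ≤ᶠ right v
  ≤right {v} {i} v∈ = proj₂ (Equivalence.to (proj₂ (proj₂ (proj₂ (subpath v))) i) v∈)

  left∈ : ∀ v → v ∈ bag (left v)
  left∈ v = ∈bag⁺ ≤-refl (proj₁ (proj₂ (proj₂ (subpath v))))

  right∈ : ∀ v → v ∈ bag (right v)
  right∈ v = ∈bag⁺ (proj₁ (proj₂ (proj₂ (subpath v)))) ≤-refl

  ∈N⇒meet : ∀ {u v} → v ∈ N[ u ] → ∃ λ i → u ∈ bag i × v ∈ bag i
  ∈N⇒meet {u} v∈ with ∈N⁻ G v∈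
  ... | inj₁ refl = left u , left∈ u , left∈ u
  ... | inj₂ u~v  = edges u~v

  last-to-start : ∀ {S} → Nonempty S → ∃ λ y → y ∈ S × (∀ {z} → z ∈ S → left z ≤ᶠ left y)
  last-to-start = argmax {_≼_ = _≤ᶠ_} Fin.≤-total ≤-trans left

  first-to-end : ∀ {S} → Nonempty S → ∃ λ x → x ∈ S × (∀ {z} → z ∈ S → right x ≤ᶠ right z)
  first-to-end = argmax {_≼_ = λ i j → j ≤ᶠ i} (λ i j → Fin.≤-total j i)
    (λ i≥j j≥k → ≤-trans j≥k i≥j) right

  -- q is w ∸ 1, so that no subtraction occurs in the bounds.
  module _ (q : ℕ) (∣bag∣≤2+q : ∀ i → ∣ bag i ∣ ≤ 2 + q) where

    -- Freeness passes to subsets of S, and the traces of free vertices are counted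
    -- by deleting the vertices of S one at a time; the others count 1 each.
    data Free (S : Subset n) (u : Fin n) : Set where
      outsider : u ∉ S → Free S u
      confined : ∀ i → N[ u ] ∩ S ⊆ bag i → ∣ bag i ∩ S ∣ ≤ suc q → Free S u

    -- The outside vertex `u` occupies one of the at most q + 2 places in the bag.
    ∣bag∩S∣≤1+q : ∀ {S u i} → u ∉ S → u ∈ bag i → ∣ bag i ∩ S ∣ ≤ suc q
    ∣bag∩S∣≤1+q {S} {u} {i} u∉S u∈i = s≤s⁻¹ (≤-trans
      (p⊂q⇒∣p∣<∣q∣ (p∩q⊆p (bag i) S , u , u∈i , λ u∈∩ → u∉S (p∩q⊆q (bag i) S u∈∩)))
      (∣bag∣≤2+q i))

    -- Deleting the vertex that starts last

    module Last {S : Subset n} {y : Fin n} (y∈S : y ∈ S)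
                (y-last : ∀ {z} → z ∈ S → left z ≤ᶠ left y) where

      B : Subset n
      B = bag (left y) ∩ S

      y∈B : y ∈ B
      y∈B = x∈p∩q⁺ (left∈ y , y∈S)

      -- An interval of `S` starts no later than `y`, so reaching a node at or after that start
      -- makes it cover the start.
      later⇒∈B : ∀ {z i} → z ∈ S → z ∈ bag i → left y ≤ᶠ i → z ∈ B
      later⇒∈B z∈S z∈i y≤i = x∈p∩q⁺ (∈bag⁺ (y-last z∈S) (≤-trans y≤i (≤right z∈i)) , z∈S)

      N[y]∩S⊆B : N[ y ] ∩ S ⊆ B
      N[y]∩S⊆B z∈ =
        let z∈N , z∈S = x∈p∩q⁻ N[ y ] S z∈
            i , y∈i , z∈i = ∈N⇒meet z∈N
        in later⇒∈B z∈S z∈i (left≤ y∈i)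

      Crossing : Subset n → Set
      Crossing = Trace G (_∈ bag (left y) ─ S) S

      -- Not restricted to traces: these sets are counted as subsets of `B` containing `y`.
      Local : Subset n → Set
      Local T = ∃ λ i → left y ≤ᶠ i × ∣ bag i ∩ S ∣ ≤ suc q × y ∈ T × T ⊆ bag i ∩ S

      FreeTrace∋y : Subset n → Set
      FreeTrace∋y T = Trace G (Free S) S T × y ∈ T

      -- For a confined vertex, its bag contains `y` and so comes no earlier than the start of `y`.
      -- An outsider that misses the starting bag of `y` but meets `y` must start later; its
      -- neighbours in `S` have all started by then, so they lie in its own starting bag, where it
      -- takes a place.
      crossing⊎local : ∀ {T} → FreeTrace∋y T → Crossing T ⊎ Local T
      crossing⊎local ((u , confined i T⊆i i≤ , refl) , y∈T) =
        inj₂ (i , left≤ (T⊆i y∈T) , i≤ , y∈T , λ z∈T →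
          x∈p∩q⁺ (T⊆i z∈T , p∩q⊆q N[ u ] S z∈T))
      crossing⊎local ((u , outsider u∉S , refl) , y∈T) with u ∈? bag (left y)
      ... | yes u∈ = inj₁ (u , x∈p∧x∉q⇒x∈p─q u∈ u∉S , refl)
      ... | no  u∉ = inj₂ (left u , y≤u , ∣bag∩S∣≤1+q u∉S (left∈ u) , y∈T , λ z∈T →
          let z∈N , z∈S = x∈p∩q⁻ N[ u ] S z∈T
              i , u∈i , z∈i = ∈N⇒meet z∈N
          in x∈p∩q⁺ (∈bag⁺ (≤-trans (y-last z∈S) y≤u) (≤-trans (left≤ u∈i) (≤right z∈i)) , z∈S))
        where
        y≤u : left y ≤ᶠ left u
        y≤u with Fin.≤-total (left y) (left u)
        ... | inj₁ y≤u = y≤u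
        -- Starting no later than `y` and still meeting it would put `u` in the bag where `y`
        -- starts.
        ... | inj₂ u≤y =
          let i , u∈i , y∈i = ∈N⇒meet (proj₁ (x∈p∩q⁻ N[ u ] S y∈T))
          in contradiction (∈bag⁺ u≤y (≤-trans (left≤ y∈i) (≤right u∈i))) u∉

      -- All q + 2 places belong to `S`, so nothing outside `S` crosses. Local sets omit an element
      -- `d` of `B`, and among the at most q + 1 remaining elements `y` is forced.
      bound-full : suc q < ∣ B ∣ → AtMost FreeTrace∋y (2 ^ q)
      bound-full 1+q<∣B∣ = AtMost-∪ crossing⊎local
        (AtMost-≤ ∣bag─S∣≤0 (AtMost-Trace G (AtMost-∈ (bag (left y) ─ S))))
        (AtMost-mono local⇒ ≤-refl (AtMost-∋⊆ y (B - d) ∣B-d∣≤1+q))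
        where
        ∣bag─S∣≤0 : ∣ bag (left y) ─ S ∣ ≤ 0
        ∣bag─S∣≤0 = +-cancelʳ-≤ ∣ B ∣ _ 0 (≤-trans
          (≤-reflexive (∣p─q∣+∣p∩q∣≡∣p∣ (bag (left y)) S)) (≤-trans (∣bag∣≤2+q _) 1+q<∣B∣))

        -- Local traces avoid d: the S-part of a later bag lies in B, is smaller than
        -- B, and so misses the element of B that ends first.
        d-props : ∃ λ d → d ∈ B × (∀ {z} → z ∈ B → right d ≤ᶠ right z)
        d-props = first-to-end (y , y∈B)

        d : Fin n
        d = proj₁ d-props

        d∈B : d ∈ B
        d∈B = proj₁ (proj₂ d-props)

        d-first : ∀ {z} → z ∈ B → right d ≤ᶠ right z
        d-first = proj₂ (proj₂ d-props)

        ∣B-d∣≤1+q : ∣ B - d ∣ ≤ suc q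
        ∣B-d∣≤1+q = s≤s⁻¹ (≤-trans (x∈p⇒∣p-x∣<∣p∣ d∈B)
          (≤-trans (∣p∩q∣≤∣p∣ (bag (left y)) S) (∣bag∣≤2+q (left y))))

        d∉ : ∀ {i} → left y ≤ᶠ i → ∣ bag i ∩ S ∣ ≤ suc q → d ∉ bag i
        d∉ {i} y≤i i≤ d∈i = <⇒≱ 1+q<∣B∣ (≤-trans (p⊆q⇒∣p∣≤∣q∣ B⊆) i≤)
          where
          B⊆ : B ⊆ bag i ∩ S
          B⊆ z∈B = let _ , z∈S = x∈p∩q⁻ _ S z∈B in
            x∈p∩q⁺ ( ∈bag⁺ (≤-trans (y-last z∈S) y≤i)
                           (≤-trans (≤right d∈i) (d-first z∈B))
                   , z∈S)

        local⇒ : ∀ {T} → Local T → y ∈ T × T ⊆ B - d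
        local⇒ (i , y≤i , i≤ , y∈T , T⊆) = y∈T , λ z∈T →
          let z∈i , z∈S = x∈p∩q⁻ (bag i) S (T⊆ z∈T)
          in x∈p∧x≢y⇒x∈p-y (later⇒∈B z∈S z∈i y≤i) λ { refl → d∉ y≤i i≤ z∈i }

      -- `B` takes p + 1 of at most q + 2 places, leaving at most q + 1 - p crossing vertices beside
      -- 2^p local sets. All but one of these vertices are paid for by the q - p halvings from 2^q
      -- to 2^p.
      bound-small : ∀ {p} → ∣ B ∣ ≡ suc p → p ≤ q → AtMost FreeTrace∋y (2 ^ q + 1)
      bound-small {p} ∣B∣≡ p≤q = AtMost-≤ ≤2^q+1 (AtMost-∪ crossing⊎local
        (AtMost-Trace G (AtMost-∈ (bag (left y) ─ S)))
        (AtMost-mono local⇒ ≤-refl (AtMost-∋⊆ y B (≤-reflexive ∣B∣≡))))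
        where
        c : ℕ
        c = ∣ bag (left y) ─ S ∣

        local⇒ : ∀ {T} → Local T → y ∈ T × T ⊆ B
        local⇒ (i , y≤i , _ , y∈T , T⊆) = y∈T , λ z∈T →
          let z∈i , z∈S = x∈p∩q⁻ (bag i) S (T⊆ z∈T) in later⇒∈B z∈S z∈i y≤i

        c≤ : c ≤ suc (q ∸ p)
        c≤ = +-cancelʳ-≤ (suc p) c _ (begin
          c + suc p             ≡⟨ cong (c +_) (sym ∣B∣≡) ⟩
          c + ∣ B ∣             ≡⟨ ∣p─q∣+∣p∩q∣≡∣p∣ (bag (left y)) S ⟩
          ∣ bag (left y) ∣      ≤⟨ ∣bag∣≤2+q (left y) ⟩
          2 + q                 ≡⟨ cong (2 +_) (sym (m∸n+n≡m p≤q)) ⟩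
          2 + (q ∸ p + p)       ≡⟨ cong suc (sym (+-suc (q ∸ p) p)) ⟩
          suc (q ∸ p) + suc p   ∎)
          where open ≤-Reasoning

        ≤2^q+1 : c + 2 ^ p ≤ 2 ^ q + 1
        ≤2^q+1 = begin
          c + 2 ^ p             ≤⟨ +-monoˡ-≤ (2 ^ p) c≤ ⟩
          suc (q ∸ p) + 2 ^ p   ≡⟨ cong suc (+-comm (q ∸ p) (2 ^ p)) ⟩
          suc (2 ^ p + (q ∸ p)) ≤⟨ s≤s (2^m+d≤2^[m+d] p (q ∸ p)) ⟩
          suc (2 ^ (p + (q ∸ p))) ≡⟨ cong (λ e → suc (2 ^ e)) (m+[n∸m]≡n p≤q) ⟩
          suc (2 ^ q)           ≡⟨ +-comm 1 (2 ^ q) ⟩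
          2 ^ q + 1             ∎
          where open ≤-Reasoning

      bound : AtMost FreeTrace∋y (2 ^ q + 1)
      bound with ∣ B ∣ ≤? suc q
      ... | no  ∣B∣≰ = AtMost-≤ (m≤m+n _ 1) (bound-full (≰⇒> ∣B∣≰))
      ... | yes ∣B∣≤ = bound-small ∣B∣≡ (s≤s⁻¹ (subst (_≤ suc q) ∣B∣≡ ∣B∣≤))
        where
        ∣B∣≡ : ∣ B ∣ ≡ suc (∣ B ∣ ∸ 1)
        ∣B∣≡ = sym (m+[n∸m]≡n (≤-trans (s≤s z≤n) (x∈p⇒∣p-x∣<∣p∣ y∈B)))

      avoiding : ∀ {P T} → Trace G P S T → y ∉ T → Trace G P (S - y) T
      avoiding (u , Pu , refl) y∉T = u , Pu , ⊆-antisym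
        (λ z∈ → let z∈N , z∈S-y = x∈p∩q⁻ N[ u ] (S - y) z∈ in
          x∈p∩q⁺ (z∈N , p─q⊆p S ⁅ y ⁆ z∈S-y))
        (λ z∈ → let z∈N , z∈S = x∈p∩q⁻ N[ u ] S z∈ in
          x∈p∩q⁺ (z∈N , x∈p∧x≢y⇒x∈p-y z∈S λ { refl → y∉T z∈ }))

      Free-del : ∀ {u} → Free S u → Free (S - y) u
      Free-del (outsider u∉S)          = outsider (u∉S ∘ p─q⊆p S ⁅ y ⁆)
      Free-del {u} (confined i ⊆i ∣i∣≤) = confined i
        (λ z∈ → let z∈N , z∈S-y = x∈p∩q⁻ N[ u ] (S - y) z∈ in
          ⊆i (x∈p∩q⁺ (z∈N , p─q⊆p S ⁅ y ⁆ z∈S-y)))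
        (≤-trans (p⊆q⇒∣p∣≤∣q∣ λ z∈ → let z∈i , z∈S-y = x∈p∩q⁻ (bag i) (S - y) z∈ in
          x∈p∩q⁺ (z∈i , p─q⊆p S ⁅ y ⁆ z∈S-y)) ∣i∣≤)

      ∣S-y∣≤ : ∀ {c} → ∣ S ∣ ≤ suc c → ∣ S - y ∣ ≤ c
      ∣S-y∣≤ ∣S∣≤ = s≤s⁻¹ (≤-trans (x∈p⇒∣p-x∣<∣p∣ y∈S) ∣S∣≤)

      ∣bag∩[S-y]∣≥ : ∀ i → y ∉ bag i → ∣ bag i ∩ S ∣ ≤ ∣ bag i ∩ (S - y) ∣
      ∣bag∩[S-y]∣≥ i y∉i = p⊆q⇒∣p∣≤∣q∣ {q = bag i ∩ (S - y)} λ z∈ →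
        let z∈i , z∈S = x∈p∩q⁻ (bag i) S z∈
        in x∈p∩q⁺ (z∈i , x∈p∧x≢y⇒x∈p-y z∈S λ { refl → y∉i z∈i })

      -- A trace missing `y` survives the deletion unchanged, and its vertex stays free; only the
      -- traces through `y` are charged to `d`.
      FreeTrace-del : ∀ {c d} → AtMost (Trace G (Free (S - y)) (S - y)) c →
                      AtMost FreeTrace∋y d → AtMost (Trace G (Free S) S) (c + d)
      FreeTrace-del = AtMost-∪ λ {T} t → split t (y ∈? T)
        where
        split : ∀ {T} → Trace G (Free S) S T → Dec (y ∈ T) →
                Trace G (Free (S - y)) (S - y) T ⊎ FreeTrace∋y T
        split t (yes y∈T) = inj₂ (t , y∈T)
        split t (no  y∉T) = let u , free , eq = avoiding t y∉T in inj₁ (u , Free-del free , eq)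

    -- Counting the traces of free vertices

    free-bound : ∀ j S → ∣ S ∣ ≤ j + suc q →
                 AtMost (Trace G (Free S) S) (2 ^ suc q + j * (2 ^ q + 1))
    free-bound j S ∣S∣≤ with ∣ S ∣ ≤? suc q
    -- With at most w = q + 1 vertices left, all subsets are counted at once, whatever `j` is.
    free-bound j S _ | yes ∣S∣≤ = AtMost-mono (λ { (u , _ , refl) → p∩q⊆q N[ u ] S })
      (≤-trans (^-monoʳ-≤ 2 ∣S∣≤) (m≤m+n _ _)) (AtMost-⊆ S)
    free-bound zero    S ∣S∣≤ | no ∣S∣≰ = contradiction ∣S∣≤ ∣S∣≰
    free-bound (suc j) S ∣S∣≤ | no ∣S∣≰ =
      let y , y∈S , y-last = last-to-start (0<∣p∣⇒Nonempty (≤-trans (s≤s z≤n) (≰⇒> ∣S∣≰)))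
          open Last y∈S y-last
      in AtMost-≤ (≤-reflexive (arith (2 ^ q) j))
           (FreeTrace-del (free-bound j (S - y) (∣S-y∣≤ ∣S∣≤)) bound)
      where
      arith : ∀ c j → 2 * c + j * (c + 1) + (c + 1) ≡ 2 * c + suc j * (c + 1)
      arith = solve-∀

    -- A full bag saves 1: once deletion reaches the vertices of that bag, the bag in
    -- which the last of them starts is full, so no outsider crosses its start.
    free-bound-full : ∀ j S i → ∣ S ∣ ≤ suc j + suc q → suc q < ∣ bag i ∩ S ∣ →
                      AtMost (Trace G (Free S) S) (2 ^ suc q + (j * (2 ^ q + 1) + 2 ^ q))
    free-bound-full j S i ∣S∣≤ full = remove j ∣S∣≤ (y ∈? bag i)
      where
      y-props : ∃ λ y → y ∈ S × (∀ {z} → z ∈ S → left z ≤ᶠ left y)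
      y-props = last-to-start (0<∣p∣⇒Nonempty
        (≤-trans (s≤s z≤n) (≤-trans full (∣p∩q∣≤∣q∣ (bag i) S))))

      y : Fin n
      y = proj₁ y-props

      open Last (proj₁ (proj₂ y-props)) (proj₂ (proj₂ y-props))

      full-B : y ∈ bag i → suc q < ∣ B ∣
      full-B y∈i = ≤-trans full (p⊆q⇒∣p∣≤∣q∣ λ z∈ →
        let z∈i , z∈S = x∈p∩q⁻ (bag i) S z∈ in later⇒∈B z∈S z∈i (left≤ y∈i))

      remove : ∀ j → ∣ S ∣ ≤ suc j + suc q → Dec (y ∈ bag i) →
               AtMost (Trace G (Free S) S) (2 ^ suc q + (j * (2 ^ q + 1) + 2 ^ q))
      remove j ∣S∣≤ (yes y∈i) =
        AtMost-≤ (≤-reflexive (+-assoc (2 ^ suc q) (j * (2 ^ q + 1)) (2 ^ q)))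
          (FreeTrace-del (free-bound j (S - y) (∣S-y∣≤ ∣S∣≤)) (bound-full (full-B y∈i)))
      -- Deleting `y` leaves at most q + 1 vertices, yet the full bag would keep q + 2 of them.
      remove zero    ∣S∣≤ (no y∉i) = contradiction (≤-trans (≤-trans full (∣bag∩[S-y]∣≥ i y∉i))
        (≤-trans (∣p∩q∣≤∣q∣ (bag i) (S - y)) (∣S-y∣≤ ∣S∣≤))) (<-irrefl refl)
      remove (suc j) ∣S∣≤ (no y∉i) =
        AtMost-≤ (≤-reflexive (arith (2 ^ q) j))
          (FreeTrace-del
            (free-bound-full j (S - y) i (∣S-y∣≤ ∣S∣≤) (≤-trans full (∣bag∩[S-y]∣≥ i y∉i)))
            bound)
        where
        arith : ∀ c j → 2 * c + (j * (c + 1) + c) + (c + 1) ≡ 2 * c + (suc j * (c + 1) + c)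
        arith = solve-∀

    -- Counting all traces

    AllTrace : Subset n → Subset n → Set
    AllTrace = Trace G (λ _ → Unit)

    -- Vertices outside `S` are free as outsiders, so a non-free vertex lies in `R` and adds at most
    -- one trace.
    exceptional-bound : ∀ {S c} R → (∀ {u} → u ∈ S → u ∉ R → Free S u) →
                        AtMost (Trace G (Free S) S) c → AtMost (AllTrace S) (c + ∣ R ∣)
    exceptional-bound {S} R free ≤c = AtMost-∪ split ≤c (AtMost-Trace G (AtMost-∈ R))
      where
      split : ∀ {T} → AllTrace S T → Trace G (Free S) S T ⊎ Trace G (_∈ R) S T
      split (u , _ , eq) with u ∈? R | u ∈? S
      ... | yes u∈R | _       = inj₂ (u , u∈R , eq)
      ... | no  u∉R | yes u∈S = inj₁ (u , free u∈S u∉R , eq)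
      ... | no  u∉R | no  u∉S = inj₁ (u , outsider u∉S , eq)

    -- If every vertex of S sees both x and y, then x and y have the same trace.
    common-neighbours : ∀ {S x y c} → ∣ S ∣ ≤ suc c → x ∈ S → y ∈ S → x ≢ y →
      AtMost (Trace G (λ u → u ∈ S × x ∈ N[ u ] × y ∈ N[ u ]) S) c
    common-neighbours {S} {x} {y} ∣S∣≤ x∈S y∈S x≢y
      with Fin.any? (λ v → (v ∈? S) ×-dec ¬? ((x ∈? N[ v ]) ×-dec (y ∈? N[ v ])))
    ... | yes (v , v∈S , ¬xy) = AtMost-mono
      (λ (u , (u∈S , xy) , eq) → u , x∈p∧x≢y⇒x∈p-y u∈S (λ { refl → ¬xy xy }) , eq)
      (s≤s⁻¹ (≤-trans (x∈p⇒∣p-x∣<∣p∣ v∈S) ∣S∣≤))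
      (AtMost-Trace G (AtMost-∈ (S - v)))
    ... | no  all-xy = AtMost-mono avoid-x
      (s≤s⁻¹ (≤-trans (x∈p⇒∣p-x∣<∣p∣ x∈S) ∣S∣≤))
      (AtMost-Trace G (AtMost-∈ (S - x)))
      where
      xy : ∀ {v} → v ∈ S → x ∈ N[ v ] × y ∈ N[ v ]
      xy {v} v∈S = decidable-stable ((x ∈? N[ v ]) ×-dec (y ∈? N[ v ]))
        λ ¬xy → all-xy (v , v∈S , ¬xy)

      same-trace : N[ y ] ∩ S ≡ N[ x ] ∩ S
      same-trace = ⊆-antisym
        (λ z∈ → let z∈S = p∩q⊆q N[ y ] S z∈ in x∈p∩q⁺ (∈N-sym G (proj₁ (xy z∈S)) , z∈S))
        (λ z∈ → let z∈S = p∩q⊆q N[ x ] S z∈ in x∈p∩q⁺ (∈N-sym G (proj₂ (xy z∈S)) , z∈S))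

      avoid-x : ∀ {T} → Trace G (λ u → u ∈ S × x ∈ N[ u ] × y ∈ N[ u ]) S T →
                Trace G (_∈ S - x) S T
      avoid-x (u , (u∈S , _) , eq) with u Fin.≟ x
      ... | yes refl = y , x∈p∧x≢y⇒x∈p-y y∈S (x≢y ∘ sym) , trans same-trace eq
      ... | no  u≢x  = u , x∈p∧x≢y⇒x∈p-y u∈S u≢x , eq

    -- Savings at the two ends of the path

    module Extremes {S x y} (x∈S : x ∈ S) (x-first : ∀ {z} → z ∈ S → right x ≤ᶠ right z)
                    (y∈S : y ∈ S) (y-last : ∀ {z} → z ∈ S → left z ≤ᶠ left y) where

      open Last y∈S y-last

      C : Subset n
      C = bag (right x) ∩ S

      -- Mirror image of `N[y]∩S⊆B`: a neighbour in `S` has started by the end of `x` and ends no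
      -- earlier.
      N[x]∩S⊆C : N[ x ] ∩ S ⊆ C
      N[x]∩S⊆C z∈ =
        let z∈N , z∈S = x∈p∩q⁻ N[ x ] S z∈
            i , x∈i , z∈i = ∈N⇒meet z∈N
        in x∈p∩q⁺ (∈bag⁺ (≤-trans (left≤ z∈i) (≤right x∈i)) (x-first z∈S) , z∈S)

      Free-x : ∣ C ∣ ≤ suc q → Free S x
      Free-x = confined (right x) (p∩q⊆p (bag (right x)) S ∘ N[x]∩S⊆C)

      Free-y : ∣ B ∣ ≤ suc q → Free S y
      Free-y = confined (left y) (p∩q⊆p (bag (left y)) S ∘ N[y]∩S⊆B)

      ∣S-x∣≤ : ∀ {c} → ∣ S ∣ ≤ suc c → ∣ S - x ∣ ≤ c
      ∣S-x∣≤ ∣S∣≤ = s≤s⁻¹ (≤-trans (x∈p⇒∣p-x∣<∣p∣ x∈S) ∣S∣≤)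

      module Crowded (∣S∣≡ : ∣ S ∣ ≡ 2 + q) (full : suc q < ∣ C ∣) where

        S⊆C : ∀ {z} → z ∈ S → z ∈ bag (right x)
        S⊆C {z} z∈S with z ∈? bag (right x)
        ... | yes z∈ = z∈
        ... | no  z∉ = contradiction (≤-trans (p⊂q⇒∣p∣<∣q∣
          (p∩q⊆q (bag (right x)) S , z , z∈S , z∉ ∘ p∩q⊆p (bag (right x)) S))
          (≤-trans (≤-reflexive ∣S∣≡) full)) (<-irrefl refl)

        -- All q + 2 vertices of `S` cover every node from the start of `y` to the end of `x`, so
        -- those bags have no room for an outsider. A vertex meeting both `x` and `y` occurs in one
        -- of those bags.
        common-neighbour∈S : ∀ {u} → x ∈ N[ u ] → y ∈ N[ u ] → u ∈ S
        common-neighbour∈S {u} x∈N y∈N with u ∈? S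
        ... | yes u∈S = u∈S
        ... | no  u∉S = contradiction impossible λ ()
          where
          crowd : ∀ {i} → left y ≤ᶠ i → i ≤ᶠ right x → u ∉ bag i
          crowd {i} y≤i i≤x u∈i = <-irrefl refl (≤-trans (≤-trans (≤-reflexive (sym ∣S∣≡))
            (p⊆q⇒∣p∣≤∣q∣ λ z∈S → x∈p∩q⁺ (∈bag⁺ (≤-trans (y-last z∈S) y≤i)
              (≤-trans i≤x (x-first z∈S)) , z∈S))) (∣bag∩S∣≤1+q u∉S u∈i))

          impossible : 1 ≤ 0
          impossible with ∈N⇒meet x∈N | ∈N⇒meet y∈N | Fin.≤-total (right x) (right u)
          ... | i , u∈i , x∈i | j , u∈j , y∈j | inj₁ x≤u =
            contradiction (∈bag⁺ (≤-trans (left≤ u∈i) (≤right x∈i)) x≤u)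
              (crowd (left≤ (S⊆C y∈S)) ≤-refl)
          ... | i , u∈i , x∈i | j , u∈j , y∈j | inj₂ u≤x =
            contradiction u∈j (crowd (left≤ y∈j) (≤-trans (≤right u∈j) u≤x))

        AllTrace-⊆S : ∀ {T} → AllTrace S T → T ⊆ S
        AllTrace-⊆S (u , _ , refl) = p∩q⊆q N[ u ] S

        missing : ∀ {T z} → T ⊆ S → z ∉ T → T ⊆ S - z
        missing T⊆S z∉T t∈T = x∈p∧x≢y⇒x∈p-y (T⊆S t∈T) λ { refl → z∉T t∈T }

        -- For distinct `x` and `y`: at most 2^(q+1) traces miss `x`, 2^q contain `x` but miss `y`,
        -- and q + 1 contain both. If `x` is `y`, the traces through it come from the q + 2 vertices
        -- of `S`, and the surplus 1 is absorbed by 2^q.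
        bound-crowded : AtMost (AllTrace S) (3 * 2 ^ q + suc q)
        bound-crowded with x Fin.≟ y
        ... | yes refl = AtMost-≤ arith (AtMost-∪ (λ {T} t → split t (x ∈? T))
          (AtMost-⊆ (S - x)) (AtMost-Trace G (AtMost-∈ S)))
          where
          split : ∀ {T} → AllTrace S T → Dec (x ∈ T) → T ⊆ S - x ⊎ Trace G (_∈ S) S T
          split t (no x∉T) = inj₁ (missing (AllTrace-⊆S t) x∉T)
          split (u , _ , refl) (yes x∈T) =
            let x∈N = p∩q⊆p N[ u ] S x∈T in inj₂ (u , common-neighbour∈S x∈N x∈N , refl)

          arith : 2 ^ ∣ S - x ∣ + ∣ S ∣ ≤ 3 * 2 ^ q + suc q
          arith = begin
            2 ^ ∣ S - x ∣ + ∣ S ∣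
              ≤⟨ +-mono-≤ (^-monoʳ-≤ 2 (∣S-x∣≤ (≤-reflexive ∣S∣≡))) (≤-reflexive ∣S∣≡) ⟩
            2 ^ suc q + (1 + suc q)        ≡⟨ sym (+-assoc (2 ^ suc q) 1 (suc q)) ⟩
            2 ^ suc q + 1 + suc q
              ≤⟨ +-monoˡ-≤ (suc q) (+-monoʳ-≤ (2 ^ suc q) (m^n>0 2 q)) ⟩
            2 ^ suc q + 2 ^ q + suc q      ≡⟨ cong (_+ suc q) (+-comm (2 ^ suc q) (2 ^ q)) ⟩
            3 * 2 ^ q + suc q              ∎
            where open ≤-Reasoning
        ... | no x≢y = AtMost-≤ arith
          (AtMost-∪ (λ {T} t → split t (x ∈? T) (y ∈? T)) (AtMost-⊆ (S - x))
            (AtMost-∪ id (AtMost-∋⊆ x (S - y) (∣S-y∣≤ (≤-reflexive ∣S∣≡)))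
              (common-neighbours (≤-reflexive ∣S∣≡) x∈S y∈S x≢y)))
          where
          split : ∀ {T} → AllTrace S T → Dec (x ∈ T) → Dec (y ∈ T) →
                  T ⊆ S - x ⊎ (x ∈ T × T ⊆ S - y) ⊎
                  Trace G (λ u → u ∈ S × x ∈ N[ u ] × y ∈ N[ u ]) S T
          split t (no  x∉T) _         = inj₁ (missing (AllTrace-⊆S t) x∉T)
          split t (yes x∈T) (no  y∉T) = inj₂ (inj₁ (x∈T , missing (AllTrace-⊆S t) y∉T))
          split (u , _ , refl) (yes x∈T) (yes y∈T) =
            let x∈N = p∩q⊆p N[ u ] S x∈T
                y∈N = p∩q⊆p N[ u ] S y∈T
            in inj₂ (inj₂ (u , (common-neighbour∈S x∈N y∈N , x∈N , y∈N) , refl))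

          rearrange : ∀ c d → 2 * c + (c + d) ≡ 3 * c + d
          rearrange = solve-∀

          arith : 2 ^ ∣ S - x ∣ + (2 ^ q + suc q) ≤ 3 * 2 ^ q + suc q
          arith = ≤-trans
            (+-monoˡ-≤ (2 ^ q + suc q) (^-monoʳ-≤ 2 (∣S-x∣≤ (≤-reflexive ∣S∣≡))))
            (≤-reflexive (rearrange (2 ^ q) (suc q)))

      -- Relative to free-bound plus 1 for each vertex of S, two units must be saved:
      -- one at x (x is free, or the bag where it ends is full) and one at y (y is
      -- free, or the bag where it starts is full). When S has w + 1 vertices, all in
      -- one bag, these two savings would coincide.
      bound-all : ∀ j → ∣ S ∣ ≡ suc j + suc q →
                  AtMost (AllTrace S) ((j + 3) * 2 ^ q + (suc q + 2 * j))
      bound-all j ∣S∣≡ with ∣ C ∣ ≤? suc q | ∣ B ∣ ≤? suc q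
      ... | yes ∣C∣≤ | yes ∣B∣≤ = AtMost-≤ total
        (exceptional-bound (S - x - y) free (free-bound (suc j) S (≤-reflexive ∣S∣≡)))
        where
        x≢y : x ≢ y
        -- If `x` were `y`, every interval of `S` would cover the end of `x`, so `C` would have j +
        -- q + 2 elements.
        x≢y refl = m+n≮n j (suc q) (≤-trans (≤-trans (≤-reflexive (sym ∣S∣≡))
          (p⊆q⇒∣p∣≤∣q∣ λ z∈S → x∈p∩q⁺ (∈bag⁺ (≤-trans (y-last z∈S) (left≤ (right∈ x))) (x-first z∈S) , z∈S)))
          ∣C∣≤)

        free : ∀ {u} → u ∈ S → u ∉ S - x - y → Free S u
        free {u} u∈S u∉ with u Fin.≟ x | u Fin.≟ y
        ... | yes refl | _        = Free-x ∣C∣≤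
        ... | no  _    | yes refl = Free-y ∣B∣≤
        ... | no  u≢x  | no  u≢y  =
          contradiction (x∈p∧x≢y⇒x∈p-y (x∈p∧x≢y⇒x∈p-y u∈S u≢x) u≢y) u∉

        ∣S-x-y∣≤ : ∣ S - x - y ∣ ≤ j + q
        ∣S-x-y∣≤ = s≤s⁻¹ (≤-trans (x∈p⇒∣p-x∣<∣p∣ (x∈p∧x≢y⇒x∈p-y y∈S (x≢y ∘ sym)))
          (≤-trans (∣S-x∣≤ (≤-reflexive ∣S∣≡)) (≤-reflexive (+-suc j q))))

        arith : ∀ c j q → 2 * c + suc j * (c + 1) + (j + q) ≡ (j + 3) * c + (suc q + 2 * j)
        arith = solve-∀

        total : 2 ^ suc q + suc j * (2 ^ q + 1) + ∣ S - x - y ∣ ≤ (j + 3) * 2 ^ q + (suc q + 2 * j)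
        total = ≤-trans (+-monoʳ-≤ (2 ^ suc q + suc j * (2 ^ q + 1)) ∣S-x-y∣≤)
          (≤-reflexive (arith (2 ^ q) j q))
      ... | yes ∣C∣≤ | no  ∣B∣≰ = AtMost-≤ total
        (exceptional-bound (S - x) free
          (FreeTrace-del (free-bound j (S - y) (∣S-y∣≤ (≤-reflexive ∣S∣≡))) (bound-full (≰⇒> ∣B∣≰))))
        where
        free : ∀ {u} → u ∈ S → u ∉ S - x → Free S u
        free {u} u∈S u∉ with u Fin.≟ x
        ... | yes refl = Free-x ∣C∣≤
        ... | no  u≢x  = contradiction (x∈p∧x≢y⇒x∈p-y u∈S u≢x) u∉

        arith : ∀ c j q → 2 * c + j * (c + 1) + c + (j + suc q) ≡ (j + 3) * c + (suc q + 2 * j)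
        arith = solve-∀

        total : 2 ^ suc q + j * (2 ^ q + 1) + 2 ^ q + ∣ S - x ∣ ≤ (j + 3) * 2 ^ q + (suc q + 2 * j)
        total = ≤-trans (+-monoʳ-≤ (2 ^ suc q + j * (2 ^ q + 1) + 2 ^ q)
          (∣S-x∣≤ (≤-reflexive ∣S∣≡))) (≤-reflexive (arith (2 ^ q) j q))
      bound-all zero ∣S∣≡ | no ∣C∣≰ | _ =
        AtMost-≤ (≤-reflexive (cong (3 * 2 ^ q +_) (sym (+-identityʳ (suc q)))))
          (Crowded.bound-crowded ∣S∣≡ (≰⇒> ∣C∣≰))
      bound-all (suc j) ∣S∣≡ | no ∣C∣≰ | yes ∣B∣≤ = AtMost-≤ total
        (exceptional-bound (S - y) free
          (free-bound-full (suc j) S (right x) (≤-reflexive ∣S∣≡) (≰⇒> ∣C∣≰)))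
        where
        free : ∀ {u} → u ∈ S → u ∉ S - y → Free S u
        free {u} u∈S u∉ with u Fin.≟ y
        ... | yes refl = Free-y ∣B∣≤
        ... | no  u≢y  = contradiction (x∈p∧x≢y⇒x∈p-y u∈S u≢y) u∉

        arith : ∀ c j q →
          2 * c + (suc j * (c + 1) + c) + (suc j + suc q) ≡ (suc j + 3) * c + (suc q + 2 * suc j)
        arith = solve-∀

        total : 2 ^ suc q + (suc j * (2 ^ q + 1) + 2 ^ q) + ∣ S - y ∣ ≤
                (suc j + 3) * 2 ^ q + (suc q + 2 * suc j)
        total = ≤-trans (+-monoʳ-≤ (2 ^ suc q + (suc j * (2 ^ q + 1) + 2 ^ q))
          (∣S-y∣≤ (≤-reflexive ∣S∣≡))) (≤-reflexive (arith (2 ^ q) j q))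
      bound-all (suc j) ∣S∣≡ | no ∣C∣≰ | no ∣B∣≰ = AtMost-≤ total
        (exceptional-bound S (λ u∈S u∉S → contradiction u∈S u∉S)
          (FreeTrace-del
            (free-bound-full j (S - y) (right x) (∣S-y∣≤ (≤-reflexive ∣S∣≡))
              (≤-trans (≰⇒> ∣C∣≰) (∣bag∩[S-y]∣≥ (right x) y∉)))
            (bound-full (≰⇒> ∣B∣≰))))
        where
        y∉ : y ∉ bag (right x)
        -- Otherwise all j + q + 3 vertices of `S` would share a bag with at most q + 2 places.
        -- Hence the bag where `x` ends stays full after `y` is deleted, and the two savings are
        -- separate.
        y∉ y∈ = m+n≮n j (2 + q) (≤-trans (≤-reflexive
            (trans (cong suc (+-suc j (suc q))) (sym ∣S∣≡)))
          (≤-trans (p⊆q⇒∣p∣≤∣q∣ λ z∈S → ∈bag⁺ (≤-trans (y-last z∈S) (left≤ y∈)) (x-first z∈S))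
            (∣bag∣≤2+q (right x))))

        arith : ∀ c j q → 2 * c + (j * (c + 1) + c) + c + (suc (suc j) + suc q) ≡
                          (suc j + 3) * c + (suc q + 2 * suc j)
        arith = solve-∀

        total : 2 ^ suc q + (j * (2 ^ q + 1) + 2 ^ q) + 2 ^ q + ∣ S ∣ ≤
                (suc j + 3) * 2 ^ q + (suc q + 2 * suc j)
        total = ≤-reflexive (trans (cong (2 ^ suc q + (j * (2 ^ q + 1) + 2 ^ q) + 2 ^ q +_) ∣S∣≡)
          (arith (2 ^ q) j q))

    trace-bound : ∀ {S} j → ∣ S ∣ ≡ suc j + suc q →
                  AtMost (AllTrace S) ((j + 3) * 2 ^ q + (suc q + 2 * j))
    trace-bound j ∣S∣≡ =
      let S≢∅ = 0<∣p∣⇒Nonempty (subst (0 <_) (sym ∣S∣≡) (s≤s z≤n))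
          x , x∈S , x-first = first-to-end S≢∅
          y , y∈S , y-last  = last-to-start S≢∅
      in Extremes.bound-all x∈S x-first y∈S y-last j ∣S∣≡

-- The bound in terms of `w` and `k`

theorem4 : ∀ {n : ℕ} (G : Graph n) (w k : ℕ) →
    HasPathwidth G w → 2 ≤ w → w + 1 ≤ k → k ≤ n →
    nc G k ≤ (k ∸ w + 2) * 2 ^ (w ∸ 1) + (2 * k ∸ w ∸ 2)
theorem4 G (suc q) k ((D , width≡) , _) _ w+1≤k _ =
  subst (λ k → nc G k ≤ (k ∸ suc q + 2) * 2 ^ q + (2 * k ∸ suc q ∸ 2)) k≡
    (nc≤ G λ S ∣S∣≡ → ncSet≤ G (AtMost-≤ (≤-reflexive (sym target))
      (trace-bound G D q (∣bag∣≤1+width G D width≡) j ∣S∣≡)))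
  where
  j : ℕ
  -- The excess of k over w + 1; the subtraction is exact because w + 1 is at most k.
  j = k ∸ (2 + q)

  k≡ : suc j + suc q ≡ k
  k≡ = trans (sym (+-suc j (suc q)))
    (m∸n+n≡m (subst (_≤ k) (cong suc (+-comm q 1)) w+1≤k))

  arith₁ : ∀ j → suc j + 2 ≡ j + 3
  arith₁ = solve-∀

  arith₂ : ∀ j q → 2 * (suc j + suc q) ≡ (suc q + 2 * j + 2) + suc q
  -- Writing 2k as a sum ending in 2 and then w makes both truncated subtractions of the bound
  -- cancel exactly.
  arith₂ = solve-∀

  target : (suc j + suc q ∸ suc q + 2) * 2 ^ q + (2 * (suc j + suc q) ∸ suc q ∸ 2) ≡
           (j + 3) * 2 ^ q + (suc q + 2 * j)
  target = cong₂ _+_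
    (cong (_* 2 ^ q) (trans (cong (_+ 2) (m+n∸n≡m (suc j) (suc q))) (arith₁ j)))
    (trans (cong (λ e → e ∸ suc q ∸ 2) (arith₂ j q))
      (trans (cong (_∸ 2) (m+n∸n≡m (suc q + 2 * j + 2) (suc q))) (m+n∸n≡m (suc q + 2 * j) 2)))
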